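{- For any finite, simple, connected, undirected graphs $G$ and $H$: if $\gamma(G)$ is odd, then $$\gamma(G\,\square\, H)\geq \frac{\left\lceil \frac{\gamma (G)}{2}\right\rceil}{2\left\lceil \frac{\gamma (G)}{2}\right\rceil-1}\,\gamma(G)\,\gamma(H),$$ and if $\gamma(G)$ is even, then $$\gamma(G\,\square\, H)\geq \frac{\gamma (G)}{2\gamma (G)-2}\,\gamma(G)\,\gamma(H).$$
   Context: All graphs are finite, simple, connected and undirected (with nonempty vertex set). For a graph $G$ and $v\in V(G)$, $N[v]$ denotes the closed neighborhood of $v$ (that is, $v$ together with all its neighbors), and $N[S]=\bigcup_{v\in S}N[v]$ for $S\subseteq V(G)$. A set $S\subseteq V(G)$ dominates $G$ if $N[S]=V(G)$. The domination number $\gamma(G)$ is the minimum cardinality of a set that dominates $G$. The Cartesian product $G\,\square\,H$ is the graph with vertex set $V(G)\times V(H)$ in which $(u_1,v_1)$ and $(u_2,v_2)$ are adjacent if and only if either $v_1=v_2$ and $u_1u_2\in E(G)$, or $u_1=u_2$ and $v_1v_2\in E(H)$. -}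

module Defs where

open import Data.Fin using (Fin; zero; remQuot)
open import Data.Fin.Properties using (_≟_; any?; all?)
open import Data.Fin.Subset using (Subset; _∈_; ∣_∣; ⊤; _-_)
open import Data.Fin.Subset.Properties using (_∈?_; anySubset?; ∈⊤; x∈p⇒∣p-x∣<∣p∣)
open import Data.Nat using (ℕ; zero; suc; _*_; _∸_; _≤_; _<_; _<?_; ⌈_/2⌉; s≤s; z≤n; NonZero; >-nonZero)
open import Data.Nat.Divisibility using (_∣_; ∣⇒≤)
open import Data.Nat.Induction using (<-wellFounded)
open import Data.Nat.Properties using (m*n≢0; ≮⇒≥; n≮0; m<n⇒0<n∸m; *-monoʳ-≤; *-monoʳ-<)
open import Data.Product using (∃; ∃-syntax; _×_; _,_; proj₁; proj₂)
open import Data.Sum using (_⊎_; inj₁; inj₂)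
open import Function using (_on_)
open import Induction.WellFounded using (Acc; acc)
open import Level using (0ℓ)
open import Relation.Binary using (Rel; Symmetric; Irreflexive; Decidable)
open import Relation.Binary.Construct.Closure.ReflexiveTransitive using (Star)
open import Relation.Binary.PropositionalEquality using (_≡_; refl; sym; subst)
open import Relation.Nullary using (¬_; yes; no; contradiction)
open import Relation.Nullary.Decidable using (_×-dec_; _⊎-dec_)
open import Relation.Unary using (Pred)
import Relation.Unary as U

-- Every finite graph is, up to isomorphism, a graph on Fin order; decidability
-- of adjacency is part of what it means constructively to be a finite graph.
record Graph : Set₁ where
  field
    order    : ℕ
    nonempty : NonZero order

  Vertex : Set
  Vertex = Fin order

  field
    _~_    : Rel Vertex 0ℓ
    _~?_   : Decidable _~_
    ~-sym  : Symmetric _~_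
    ~-irrefl : Irreflexive _≡_ _~_

  N[_] : Vertex → Pred Vertex 0ℓ
  N[ v ] u = u ≡ v ⊎ v ~ u

  N[_]ˢ : Subset order → Pred Vertex 0ℓ
  N[ S ]ˢ u = ∃[ v ] v ∈ S × u U.∈ N[ v ]

  Dominates : Subset order → Set
  Dominates S = ∀ u → u U.∈ N[ S ]ˢ

  record IsDominationNumber (k : ℕ) : Set where
    field
      attained : ∃[ S ] Dominates S × ∣ S ∣ ≡ k
      minimal  : ∀ S → Dominates S → k ≤ ∣ S ∣

  Connected : Set
  Connected = ∀ u v → Star _~_ u v

module _ (G : Graph) where
  open Graph G

  dominates? : U.Decidable Dominates
  dominates? S = all? λ u → any? λ v → (v ∈? S) ×-dec ((u ≟ v) ⊎-dec (v ~? u))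

  private
    descend : ∀ S → Dominates S → Acc _<_ ∣ S ∣ → ∃ IsDominationNumber
    descend S dom (acc rs)
      with anySubset? (λ T → dominates? T ×-dec (∣ T ∣ <? ∣ S ∣))
    ... | yes (T , domT , T<S) = descend T domT (rs T<S)
    ... | no ∄T = ∣ S ∣ , record
      { attained = S , dom , refl
      ; minimal  = λ T domT → ≮⇒≥ λ T<S → ∄T (T , domT , T<S)
      }

  dominationNumber : ∃ IsDominationNumber
  dominationNumber = descend ⊤ (λ u → u , ∈⊤ , inj₁ refl) (<-wellFounded _)

  γ : ℕ
  γ = proj₁ dominationNumber

  γ-isDominationNumber : IsDominationNumber γ
  γ-isDominationNumber = proj₂ dominationNumber

-- Fin (m * n) stands for Fin m × Fin n via the bijection remQuot n.
infixr 7 _□_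
_□_ : Graph → Graph → Graph
G □ H = record
  { order    = G.order * H.order
  ; nonempty = m*n≢0 G.order H.order {{G.nonempty}} {{H.nonempty}}
  ; _~_      = _~′_ on remQuot H.order
  ; _~?_     = λ x y → remQuot H.order x ~′? remQuot H.order y
  ; ~-sym    = ~′-sym
  ; ~-irrefl = λ { refl → ~′-irrefl }
  }
  where
  module G = Graph G
  module H = Graph H

  _~′_ : Rel (G.Vertex × H.Vertex) 0ℓ
  (u₁ , v₁) ~′ (u₂ , v₂) = (v₁ ≡ v₂ × u₁ G.~ u₂) ⊎ (u₁ ≡ u₂ × v₁ H.~ v₂)

  _~′?_ : Decidable _~′_
  (u₁ , v₁) ~′? (u₂ , v₂) =
    ((v₁ ≟ v₂) ×-dec (u₁ G.~? u₂)) ⊎-dec ((u₁ ≟ u₂) ×-dec (v₁ H.~? v₂))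

  ~′-sym : Symmetric _~′_
  ~′-sym (inj₁ (eq , adj)) = inj₁ (sym eq , G.~-sym adj)
  ~′-sym (inj₂ (eq , adj)) = inj₂ (sym eq , H.~-sym adj)

  ~′-irrefl : ∀ {x} → ¬ (x ~′ x)
  ~′-irrefl (inj₁ (_ , adj)) = G.~-irrefl refl adj
  ~′-irrefl (inj₂ (_ , adj)) = H.~-irrefl refl adj

γ-nonZero : ∀ G → NonZero (γ G)
γ-nonZero G with γ G | γ-isDominationNumber G
... | suc _ | _ = _
... | zero  | isγ =
    impossible (Graph.order G) (Graph.nonempty G) S
    (λ u → let v , v∈S , _ = dom u in v , v∈S) ∣S∣≡0
  where
  open Graph.IsDominationNumber isγ
  S = proj₁ attained
  dom = proj₁ (proj₂ attained)
  ∣S∣≡0 = proj₂ (proj₂ attained)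

  impossible : ∀ n → NonZero n → (S : Subset n) → (Fin n → ∃[ v ] v ∈ S) →
               ∣ S ∣ ≡ 0 → NonZero 0
  impossible (suc n) _ S member eq with member zero
  ... | v , v∈S = contradiction (subst (∣ S - v ∣ <_) eq (x∈p⇒∣p-x∣<∣p∣ v∈S)) n≮0

-- The truncated subtractions in the denominators below never truncate,
-- because γ G ≥ 1, and γ G ≥ 2 when it is even.
oddDenominator-nonZero : ∀ G → NonZero (2 * ⌈ γ G /2⌉ ∸ 1)
oddDenominator-nonZero G = lemma (γ G) (γ-nonZero G)
  where
  lemma : ∀ n → NonZero n → NonZero (2 * ⌈ n /2⌉ ∸ 1)
  lemma (suc n) _ = >-nonZero (m<n⇒0<n∸m (*-monoʳ-≤ 2 (s≤s z≤n)))

evenDenominator-nonZero : ∀ G → 2 ∣ γ G → NonZero (2 * γ G ∸ 2)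
evenDenominator-nonZero G 2∣γ =
  >-nonZero (m<n⇒0<n∸m (*-monoʳ-< 2 (∣⇒≤ {{γ-nonZero G}} 2∣γ)))

{-# OPTIONS --safe #-}

-- Let n = γ(G), let D be a minimum dominating set of G □ H, and let d(v) be the
-- number of its vertices in the copy of G over v ∈ V(H).  Write Δ = |D| and let
-- q count the columns with d(v) = 1.  Among the dominating sets of H made of
-- columns with d(v) ≥ 1, let W minimise the total weight, where a column weighs
-- n + 2 if d(v) = 1 and n + 1 otherwise; let M = |W|, and let a ≤ q be the
-- number of columns v ∈ W with d(v) = 1.
--
-- (1) Partition V(G) into n classes, each contained in a closed neighbourhood.
-- For each class, the columns where D meets it, together with those where no
-- neighbouring column meets it, form a dominating set of H that W does not
-- outweigh.  A column v lies in at most 2 d(v) of these n sets.  If the partition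
-- minimises the number of non-adjacent pairs inside classes, then no N[x]
-- contains a class other than that of x, so a column with d(v) = 1 lies in only
-- one of them.  Hence n((n+1)M + a) + nq ≤ 2(n+1)Δ.
--
-- (2) Exchange the roles of G and H, and partition V(H) into stars centred at W.
-- As in Zerbib's improvement of the Clark–Suen bound, the minimality of W yields
-- n((n+1)M + a) + 2(n+2)M ≤ (2n+3)Δ + q + (n+2)a.
--
-- Three times (1) plus 2n times (2) gives n(2n²+9n+11) γ(H) ≤ (4n²+12n+6) Δ,
-- which implies the theorem except for n = 2.  In that case each column lies in
-- at most d(v) of the two sets in (1), so 2 γ(H) ≤ Δ.
module Submission where

open import Defs
open import Data.Integer using (+_)
open import Data.Nat using (⌈_/2⌉) renaming (_*_ to _*ℕ_; _∸_ to _∸ℕ_)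
open import Data.Nat.Divisibility using (_∣_)
open import Data.Product using (_×_)
open import Data.Rational using (_/_; _*_; _≥_)
open import Relation.Nullary using (¬_)

open import Data.Fin using (Fin; zero; suc; combine; remQuot; _↑ˡ_; _↑ʳ_)
open import Data.Fin.Properties using (_≟_; any?; all?; remQuot-combine; combine-remQuot)
open import Data.Fin.Subset using (Subset; _∈_; ∣_∣; inside; outside)
open import Data.Fin.Subset.Properties using (_∈?_; anySubset?)
import Data.Integer as ℤ
import Data.Integer.Properties as ℤ
import Data.Nat as ℕ
open import Data.Nat using (ℕ; zero; suc; _≤_; _<_; z≤n; s≤s; _<?_; NonZero) renaming (_+_ to _+ℕ_)
open import Data.Nat.Divisibility using (divides)
open import Data.Nat.Induction using (<-wellFounded)
open import Data.Nat.Properties hiding (_≟_)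
open import Data.Nat.Tactic.RingSolver using (solve-∀)
open import Data.Product using (∃; _,_; proj₁; proj₂)
open import Data.Rational using (toℚᵘ)
import Data.Rational.Properties as ℚ
open import Data.Rational.Unnormalised using (mkℚᵘ; *≤*) renaming (_*_ to _*ᵘ_)
import Data.Rational.Unnormalised.Properties as ℚᵘ
open import Data.Sum using (_⊎_; inj₁; inj₂; [_,_]′)
open import Data.Vec using (_∷_; []; tabulate; here; there)
open import Data.Vec.Properties using (lookup⇒[]=; []=⇒lookup; lookup∘tabulate)
open import Function using (_∘_; id)
open import Induction.WellFounded using (Acc; acc)
open import Level using (0ℓ)
open import Relation.Binary.PropositionalEquality
open import Relation.Nullary using (Dec; yes; no; does; contradiction)
open import Relation.Nullary.Decidable using (_×-dec_; _⊎-dec_; _→-dec_; ¬?; decidable-stable; dec-true)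
open import Relation.Unary using (Pred; Decidable)
import Relation.Unary as U
open import Algebra.Properties.Semiring.Sum +-*-semiring
  using (sum; sum-cong-≗; ∑-distrib-+; ∑-comm; *-distribˡ-sum; *-distribʳ-sum)

-- Indicators of decidable propositions and counting by finite sums.

private variable
  m n k : ℕ
  P Q R : Set

χ : Dec P → ℕ
χ (yes _) = 1
χ (no  _) = 0

χ-yes : (d : Dec P) → P → χ d ≡ 1
χ-yes (yes _) _ = refl
χ-yes (no ¬p) p = contradiction p ¬p

χ-no : (d : Dec P) → ¬ P → χ d ≡ 0
χ-no (yes p) ¬p = contradiction p ¬p
χ-no (no _)  _  = refl

χ-mono : (d : Dec P) (e : Dec Q) → (P → Q) → χ d ≤ χ e
χ-mono (no _)  _ _ = z≤n
χ-mono (yes p) e f = ≤-reflexive (sym (χ-yes e (f p)))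

χ-cong : (d : Dec P) (e : Dec Q) → (P → Q) → (Q → P) → χ d ≡ χ e
χ-cong d e f g = ≤-antisym (χ-mono d e f) (χ-mono e d g)

χ≤1 : (d : Dec P) → χ d ≤ 1
χ≤1 (yes _) = ≤-refl
χ≤1 (no _)  = z≤n

χ-⊎ : (d : Dec P) (e : Dec Q) (r : Dec R) → (R → P ⊎ Q) → χ r ≤ χ d +ℕ χ e
χ-⊎ d e (no _)  _ = z≤n
χ-⊎ d e (yes r) f with f r
... | inj₁ p = ≤-trans (≤-reflexive (sym (χ-yes d p))) (m≤m+n _ _)
... | inj₂ q = ≤-trans (≤-reflexive (sym (χ-yes e q))) (m≤n+m _ _)

χ-× : (d : Dec P) (e : Dec Q) → χ (d ×-dec e) ≡ χ d *ℕ χ e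
χ-× d e with d | e
... | yes _ | yes _ = refl
... | yes _ | no _  = refl
... | no _  | _     = refl

χ-+-¬ : (d : Dec P) → χ d +ℕ χ (¬? d) ≡ 1
χ-+-¬ (yes _) = refl
χ-+-¬ (no _)  = refl

sum-mono-≤ : {f g : Fin n → ℕ} → (∀ i → f i ≤ g i) → sum f ≤ sum g
sum-mono-≤ {zero}  _  = z≤n
sum-mono-≤ {suc n} le = +-mono-≤ (le zero) (sum-mono-≤ (le ∘ suc))

sum-mono-< : {f g : Fin n → ℕ} → (∀ i → f i ≤ g i) → ∀ j → f j < g j → sum f < sum g
sum-mono-< le zero    lt = +-mono-<-≤ lt (sum-mono-≤ (le ∘ suc))
sum-mono-< le (suc j) lt = +-mono-≤-< (le zero) (sum-mono-< (le ∘ suc) j lt)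

sum-const : ∀ n (c : ℕ) → sum {n} (λ _ → c) ≡ n *ℕ c
sum-const zero    c = refl
sum-const (suc n) c = cong (c +ℕ_) (sum-const n c)

term≤sum : (f : Fin n → ℕ) → ∀ j → f j ≤ sum f
term≤sum f zero    = m≤m+n _ _
term≤sum f (suc j) = ≤-trans (term≤sum (f ∘ suc) j) (m≤n+m _ _)

sum-χ≟ : (a : Fin n) (c : Fin n → ℕ) → sum (λ i → χ (a ≟ i) *ℕ c i) ≡ c a
sum-χ≟ {suc n} zero c = begin
  1 *ℕ c zero +ℕ sum (λ i → χ (zero ≟ suc i) *ℕ c (suc i))
    ≡⟨ cong₂ _+ℕ_ (*-identityˡ (c zero)) (trans (sum-const n 0) (*-zeroʳ n)) ⟩
  c zero +ℕ 0 ≡⟨ +-identityʳ _ ⟩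
  c zero      ∎
  where open ≡-Reasoning
sum-χ≟ (suc a) c = trans
  (sum-cong-≗ λ i → cong (_*ℕ c (suc i)) (χ-cong (suc a ≟ suc i) (a ≟ i) (λ { refl → refl }) (cong suc)))
  (sum-χ≟ a (c ∘ suc))

# : {P : Pred (Fin n) 0ℓ} → Decidable P → ℕ
# P? = sum (λ i → χ (P? i))

#-mono : {P Q : Pred (Fin n) 0ℓ} (P? : Decidable P) (Q? : Decidable Q) → (∀ {i} → P i → Q i) → # P? ≤ # Q?
#-mono P? Q? f = sum-mono-≤ λ i → χ-mono (P? i) (Q? i) f

χ-∃ : {P : Pred (Fin n) 0ℓ} (P? : Decidable P) (d : Dec (∃ P)) → χ d ≤ # P?
χ-∃ P? (no _)        = z≤n
χ-∃ P? (yes (i , p)) = ≤-trans (≤-reflexive (sym (χ-yes (P? i) p))) (term≤sum _ i)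

#-unique : {P : Pred (Fin n) 0ℓ} (P? : Decidable P) (a : Fin n) → (∀ {i} → P i → a ≡ i) → # P? ≤ 1
#-unique P? a h = ≤-trans (sum-mono-≤ λ i → ≤-trans (χ-mono (P? i) (a ≟ i) h) (≤-reflexive (sym (*-identityʳ _))))
                          (≤-reflexive (sum-χ≟ a (λ _ → 1)))

#-image : {P : Pred (Fin n) 0ℓ} (P? : Decidable P) (f : Fin n → Fin k) →
          # (λ j → any? λ i → P? i ×-dec (f i ≟ j)) ≤ # P?
#-image P? f = begin
  # (λ j → any? λ i → P? i ×-dec (f i ≟ j))
    ≤⟨ sum-mono-≤ (λ j → χ-∃ (λ i → P? i ×-dec (f i ≟ j)) _) ⟩
  sum (λ j → sum λ i → χ (P? i ×-dec (f i ≟ j)))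
    ≡⟨ ∑-comm (λ j i → χ (P? i ×-dec (f i ≟ j))) ⟩
  sum (λ i → sum λ j → χ (P? i ×-dec (f i ≟ j)))
    ≡⟨ sum-cong-≗ (λ i → sum-cong-≗ λ j → trans (χ-× (P? i) (f i ≟ j)) (*-comm (χ (P? i)) _)) ⟩
  sum (λ i → sum λ j → χ (f i ≟ j) *ℕ χ (P? i))
    ≡⟨ sum-cong-≗ (λ i → sum-χ≟ (f i) (λ _ → χ (P? i))) ⟩
  # P? ∎
  where open ≤-Reasoning

-- Subsets of `Fin n`, minimisation over them, and sums over products.

subset : {P : Pred (Fin n) 0ℓ} → Decidable P → Subset n
subset P? = tabulate (does ∘ P?)

∈-subset⁺ : {P : Pred (Fin n) 0ℓ} (P? : Decidable P) → ∀ {i} → P i → i ∈ subset P?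
∈-subset⁺ P? {i} p = lookup⇒[]= i _ (trans (lookup∘tabulate _ i) (dec-true (P? i) p))

∈-subset⁻ : {P : Pred (Fin n) 0ℓ} (P? : Decidable P) → ∀ {i} → i ∈ subset P? → P i
∈-subset⁻ P? {i} i∈ with P? i | trans (sym (lookup∘tabulate (does ∘ P?) i)) ([]=⇒lookup i∈)
... | yes p | _ = p

∣p∣≡# : (p : Subset n) → ∣ p ∣ ≡ # (_∈? p)
∣p∣≡# []            = refl
∣p∣≡# (inside ∷ p)  = cong suc (trans (∣p∣≡# p) (sum-cong-≗ λ i → χ-cong (i ∈? p) (suc i ∈? (inside ∷ p)) there λ { (there q) → q }))
∣p∣≡# (outside ∷ p) = trans (∣p∣≡# p) (sum-cong-≗ λ i → χ-cong (i ∈? p) (suc i ∈? (outside ∷ p)) there λ { (there q) → q })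

enumerate : (p : Subset n) → ∃ λ (u : Fin ∣ p ∣ → Fin n) → ∀ {x} → x ∈ p → ∃ λ i → u i ≡ x
enumerate [] = (λ ()) , λ ()
enumerate (inside ∷ p) with enumerate p
... | u , surj = (λ { zero → zero ; (suc i) → suc (u i) })
               , λ { here → zero , refl ; (there q) → let i , eq = surj q in suc i , cong suc eq }
enumerate (outside ∷ p) with enumerate p
... | u , surj = suc ∘ u , λ { (there q) → let i , eq = surj q in i , cong suc eq }

argmin : {P : Pred (Subset n) 0ℓ} → Decidable P → (μ : Subset n → ℕ) → ∃ P →
         ∃ λ S → P S × (∀ T → P T → μ S ≤ μ T)
argmin {P = P} P? μ (S₀ , p₀) = descend S₀ p₀ (<-wellFounded _)
  where
  descend : ∀ S → P S → Acc _<_ (μ S) → ∃ λ S → P S × (∀ T → P T → μ S ≤ μ T)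
  descend S p (acc rs) with anySubset? (λ T → P? T ×-dec (μ T <? μ S))
  ... | yes (T , q , lt) = descend T q (rs lt)
  ... | no ∄             = S , p , λ T q → ≮⇒≥ λ lt → ∄ (T , q , lt)

sum-combine : ∀ m n (f : Fin (m *ℕ n) → ℕ) → sum f ≡ sum {m} (λ i → sum {n} λ j → f (combine i j))
sum-combine zero    n f = refl
sum-combine (suc m) n f = trans (split n (m *ℕ n) f) (cong (sum (λ j → f (combine {suc m} zero j)) +ℕ_) (sum-combine m n (λ i → f (n ↑ʳ i))))
  where
  split : ∀ a b (g : Fin (a +ℕ b) → ℕ) → sum g ≡ sum (λ i → g (i ↑ˡ b)) +ℕ sum (λ j → g (a ↑ʳ j))
  split zero    b g = refl
  split (suc a) b g = trans (cong (g zero +ℕ_) (split a b (g ∘ suc))) (sym (+-assoc (g zero) _ _))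

#≡1⇒unique : {P : Pred (Fin n) 0ℓ} (P? : Decidable P) → # P? ≡ 1 →
              ∃ λ a → P a × (∀ {i} → P i → a ≡ i)
#≡1⇒unique {zero} P? ()
#≡1⇒unique {suc n} P? eq with P? zero
... | yes p = zero , p , λ { {zero} _ → refl ; {suc i} q → contradiction
        (≤-trans (≤-reflexive (sym (χ-yes (P? (suc i)) q)))
          (≤-trans (term≤sum (λ i → χ (P? (suc i))) i) (≤-reflexive (suc-injective eq)))) λ () }
... | no ¬p = let a , pa , u = #≡1⇒unique (P? ∘ suc) eq in
              suc a , pa , λ { {zero} q → contradiction q ¬p ; {suc i} q → cong suc (u q) }

someVertex : (G : Graph) → Graph.Vertex G
someVertex G with Graph.order G | Graph.nonempty G
... | suc _ | _ = zero

-- Partitions of a graph into classes lying in closed neighbourhoods.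

module Domination (G : Graph) {γG : ℕ} (isγ : Graph.IsDominationNumber G γG) where
  open Graph G public

  Covers : Pred Vertex 0ℓ → Set
  Covers P = ∀ x → ∃ λ y → P y × x U.∈ N[ y ]

  N? : ∀ y x → Dec (x U.∈ N[ y ])
  N? y x = (x ≟ y) ⊎-dec (y ~? x)

  γ≤# : {P : Pred Vertex 0ℓ} (P? : Decidable P) → Covers P → γG ≤ # P?
  γ≤# P? cov = begin
    γG             ≤⟨ IsDominationNumber.minimal isγ S
                        (λ x → let y , p , x∈N = cov x in y , ∈-subset⁺ P? p , x∈N) ⟩
    ∣ S ∣          ≡⟨ ∣p∣≡# S ⟩
    # (_∈? S)      ≤⟨ #-mono (_∈? S) P? (∈-subset⁻ P?) ⟩
    # P?           ∎
    where
    open ≤-Reasoning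
    S = subset P?

  -- A centre need not belong to its own class: `Move` may take the old centre out of a class and
  -- still leave it as centre.
  record StarPartition : Set where
    field
      class  : Vertex → Fin γG
      centre : Fin γG → Vertex
      near   : ∀ x → x U.∈ N[ centre (class x) ]

    -- Otherwise X together with the centres of the classes outside I would
    -- be a dominating set with fewer than γG elements.
    #hidden≤ : {X : Pred Vertex 0ℓ} {I : Pred (Fin γG) 0ℓ} (X? : Decidable X) (I? : Decidable I) →
               (∀ y → (∃ λ x → X x × y U.∈ N[ x ]) ⊎ ¬ I (class y)) → # I? ≤ # X?
    #hidden≤ {X} {I} X? I? hyp = +-cancelʳ-≤ (# ¬I?) (# I?) (# X?) (begin
      # I? +ℕ # ¬I?                              ≡⟨ ∑-distrib-+ (λ i → χ (I? i)) (λ i → χ (¬I? i)) ⟨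
      sum (λ i → χ (I? i) +ℕ χ (¬I? i))          ≡⟨ sum-cong-≗ (λ i → χ-+-¬ (I? i)) ⟩
      sum {γG} (λ _ → 1)                        ≡⟨ trans (sum-const γG 1) (*-identityʳ _) ⟩
      γG                                        ≤⟨ γ≤# T? cover ⟩
      # T?                                       ≤⟨ sum-mono-≤ (λ y → χ-⊎ (X? y) (Z? y) (T? y) id) ⟩
      sum (λ y → χ (X? y) +ℕ χ (Z? y))           ≡⟨ ∑-distrib-+ (λ y → χ (X? y)) (λ y → χ (Z? y)) ⟩
      # X? +ℕ # Z?                               ≤⟨ +-monoʳ-≤ (# X?) (#-image ¬I? centre) ⟩
      # X? +ℕ # ¬I?                              ∎)
      where
      open ≤-Reasoning
      ¬I? = λ i → ¬? (I? i)
      Z?  = λ y → any? λ i → ¬I? i ×-dec (centre i ≟ y)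
      T?  = λ y → X? y ⊎-dec Z? y
      cover : Covers (λ y → X y ⊎ ∃ λ i → ¬ I i × centre i ≡ y)
      cover y with hyp y
      ... | inj₁ (x , p , y∈N) = x , inj₁ p , y∈N
      ... | inj₂ ¬i = centre (class y) , inj₂ (class y , ¬i , refl) , near y

    -- Positive form of "`N[ x ]` contains no class other than that of `x`"; the escaping vertex `y`
    -- is what `cost-single` works with.
    Fair : Set
    Fair = ∀ x i → i ≢ class x → ∃ λ y → class y ≡ i × ¬ y U.∈ N[ x ]

    -- Potential for the descent in `fairPartition`; pairs are ordered.
    defect : ℕ
    defect = sum λ x → sum λ y → χ ((class x ≟ class y) ×-dec ¬? (N? x y))

  open StarPartition public

  N-sym : ∀ {x y} → y U.∈ N[ x ] → x U.∈ N[ y ]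
  N-sym (inj₁ eq) = inj₁ (sym eq)
  N-sym (inj₂ x~y) = inj₂ (~-sym x~y)

  starPartition : StarPartition
  starPartition with IsDominationNumber.attained isγ
  -- Matching on `refl` makes `γG` the size of `S`, so the members of `S` index the classes; each
  -- vertex joins a member that dominates it.
  ... | S , dom , refl = record
    { class  = λ x → proj₁ (index x)
    ; centre = proj₁ (enumerate S)
    ; near   = λ x → subst (λ v → x U.∈ N[ v ]) (sym (proj₂ (index x))) (proj₂ (proj₂ (dom x))) }
    where
    index = λ x → proj₂ (enumerate S) (proj₁ (proj₂ (dom x)))

  -- Since `N[ x ]` absorbs the class `i`, the vertex `x` can join that class and become its centre.
  module Move (π : StarPartition) {x i} (i≢ : i ≢ class π x)
              (absorbed : ∀ y → class π y ≡ i → y U.∈ N[ x ]) where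

    -- Otherwise `x` alone would dominate two whole classes, `i` and its own, and `#hidden≤` would
    -- give 2 ≤ 1.
    witness : ∃ λ y → class π y ≡ class π x × ¬ y U.∈ N[ x ]
    witness with any? (λ y → (class π y ≟ class π x) ×-dec ¬? (N? x y))
    ... | yes w = w
    ... | no ∄  = contradiction (begin
      2                                              ≡⟨ cong₂ _+ℕ_ (sum-χ≟ i (λ _ → 1)) (sum-χ≟ (class π x) (λ _ → 1)) ⟨
      sum (λ j → χ (i ≟ j) *ℕ 1) +ℕ sum (λ j → χ (class π x ≟ j) *ℕ 1)
        ≡⟨ ∑-distrib-+ (λ j → χ (i ≟ j) *ℕ 1) _ ⟨
      sum (λ j → χ (i ≟ j) *ℕ 1 +ℕ χ (class π x ≟ j) *ℕ 1)
        ≤⟨ sum-mono-≤ both ⟩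
      # I?                                           ≤⟨ #hidden≤ π (x ≟_) I? hidden ⟩
      # (x ≟_)                                       ≤⟨ #-unique (x ≟_) x id ⟩
      1                                              ∎) λ { (s≤s ()) }
      where
      open ≤-Reasoning
      I? = λ j → (i ≟ j) ⊎-dec (class π x ≟ j)
      both : ∀ j → χ (i ≟ j) *ℕ 1 +ℕ χ (class π x ≟ j) *ℕ 1 ≤ χ (I? j)
      both j with i ≟ j | class π x ≟ j
      ... | yes i≡j | yes x≡j = contradiction (trans i≡j (sym x≡j)) i≢
      ... | yes _   | no _    = ≤-refl
      ... | no _    | yes _   = ≤-refl
      ... | no _    | no _    = ≤-refl
      hidden : ∀ y → (∃ λ z → x ≡ z × y U.∈ N[ z ]) ⊎ ¬ (i ≡ class π y ⊎ class π x ≡ class π y)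
      hidden y with N? x y
      ... | yes y∈N = inj₁ (x , refl , y∈N)
      ... | no y∉N  = inj₂ λ { (inj₁ eq) → y∉N (absorbed y (sym eq)) ; (inj₂ eq) → ∄ (y , sym eq , y∉N) }

    newClass : Vertex → Fin γG
    newClass y with x ≟ y
    ... | yes _ = i
    ... | no _  = class π y

    newCentre : Fin γG → Vertex
    newCentre j with i ≟ j
    ... | yes _ = x
    ... | no _  = centre π j

    newClass-x : newClass x ≡ i
    newClass-x with x ≟ x
    ... | yes _ = refl
    ... | no x≢x = contradiction refl x≢x

    newClass-≡ : ∀ y → x ≢ y → newClass y ≡ class π y
    newClass-≡ y x≢y with x ≟ y
    ... | yes x≡y = contradiction x≡y x≢y
    ... | no _    = refl

    joined : ∀ y → newClass y ≡ i → y U.∈ N[ x ]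
    joined y eq with x ≟ y
    ... | yes x≡y = inj₁ (sym x≡y)
    ... | no _    = absorbed y eq

    newNear : ∀ y → y U.∈ N[ newCentre (newClass y) ]
    newNear y with i ≟ newClass y
    ... | yes eq = joined y (sym eq)
    ... | no i≢y with x ≟ y
    ...   | yes _ = contradiction refl i≢y
    ...   | no _  = near π y

    moved : StarPartition
    moved = record { class = newClass ; centre = newCentre ; near = newNear }

    -- The enlarged class lies in `N[ x ]`, so no pair involving `x` counts any more. Pairs avoiding
    -- `x` are unchanged, and the pair of `x` with `witness` is lost.
    defect-decreases : defect moved < defect π
    defect-decreases = sum-mono-< (λ y → sum-mono-≤ (le y)) x
      (sum-mono-< (le x) w (begin-strict
        χ ((newClass x ≟ newClass w) ×-dec ¬? (N? x w))   ≡⟨ χ-no _ (λ (eq , w∉N) → w∉N (joined w (trans (sym eq) newClass-x))) ⟩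
        0                                                 <⟨ s≤s z≤n ⟩
        1                                                 ≡⟨ χ-yes _ (sym eqw , w∉N) ⟨
        χ ((class π x ≟ class π w) ×-dec ¬? (N? x w))     ∎))
      where
      open ≤-Reasoning
      w = proj₁ witness
      eqw = proj₁ (proj₂ witness)
      w∉N = proj₂ (proj₂ witness)
      le : ∀ y z → χ ((newClass y ≟ newClass z) ×-dec ¬? (N? y z)) ≤ χ ((class π y ≟ class π z) ×-dec ¬? (N? y z))
      le y z = χ-mono ((newClass y ≟ newClass z) ×-dec ¬? (N? y z)) ((class π y ≟ class π z) ×-dec ¬? (N? y z)) (λ (eq , z∉N) → same (x ≟ y) (x ≟ z) eq z∉N , z∉N)
        where
        same : Dec (x ≡ y) → Dec (x ≡ z) → newClass y ≡ newClass z → ¬ z U.∈ N[ y ] → class π y ≡ class π z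
        same (yes refl) _          eq z∉N = contradiction (joined z (trans (sym eq) newClass-x)) z∉N
        same (no _)     (yes refl) eq z∉N = contradiction (N-sym (joined y (trans eq newClass-x))) z∉N
        same (no x≢y)   (no x≢z)   eq _   = trans (sym (newClass-≡ y x≢y)) (trans eq (newClass-≡ z x≢z))

  fairPartition : ∃ Fair
  fairPartition = descend starPartition (<-wellFounded _)
    where
    descend : ∀ π → Acc _<_ (defect π) → ∃ Fair
    descend π (acc rs) with any? (λ x → any? λ i →
        ¬? (i ≟ class π x) ×-dec all? λ y → ¬? ((class π y ≟ i) ×-dec ¬? (N? x y)))
    ... | yes (x , i , i≢ , h) = descend moved (rs defect-decreases)
      where open Move π i≢ (λ y eq → decidable-stable (N? x y) λ y∉N → h y (eq , y∉N))
    ... | no ∄ = π , fair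
      where
      fair : Fair π
      fair x i i≢ with any? (λ y → (class π y ≟ i) ×-dec ¬? (N? x y))
      ... | yes found = found
      ... | no none   = contradiction (x , i , i≢ , λ y p → none (y , p)) ∄

-- Counting a dominating set of the product by columns.

Combined : ℕ → ℕ → ℕ → Set
Combined n m d = n *ℕ (2 *ℕ n *ℕ n +ℕ 9 *ℕ n +ℕ 11) *ℕ m ≤ (4 *ℕ n *ℕ n +ℕ 12 *ℕ n +ℕ 6) *ℕ d

-- The dominating set enters as a relation `D` on pairs, which keeps the encoding of the product
-- vertices out of the counting.
module Bounds (G H : Graph) {γG γH : ℕ}
  (isγG : Graph.IsDominationNumber G γG) (isγH : Graph.IsDominationNumber H γH)
  {D : Fin (Graph.order G) → Fin (Graph.order H) → Set} (D? : ∀ x v → Dec (D x v))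
  (dominates : ∀ x v → (∃ λ y → D y v × x U.∈ Graph.N[_] G y) ⊎ (∃ λ w → D x w × Graph._~_ H v w))
  where

  module G = Domination G isγG
  module H = Domination H isγH

  col : H.Vertex → ℕ
  col v = # (λ x → D? x v)

  occupied : ∀ {x v} → D x v → 1 ≤ col v
  occupied {x} {v} d = ≤-trans (≤-reflexive (sym (χ-yes (D? x v) d))) (term≤sum (λ x → χ (D? x v)) x)

  ∣D∣ : ℕ
  ∣D∣ = sum col

  single? : ∀ v → Dec (col v ≡ 1)
  single? v = col v ℕ.≟ 1

  -- Dominating sets of `H` obtained from the classes of `G`.

  module Rows (π : G.StarPartition) (fair : G.Fair π) where
    open G.StarPartition π using (class)

    Above Beside Row : Fin γG → Pred H.Vertex 0ℓ
    Above  i v = ∃ λ x → D x v × class x ≡ i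
    Beside i v = ∃ λ w → v H.~ w × Above i w
    Row    i v = Above i v ⊎ ¬ Beside i v

    Above? : ∀ i v → Dec (Above i v)
    Above? i v = any? λ x → D? x v ×-dec (class x ≟ i)

    Beside? : ∀ i v → Dec (Beside i v)
    Beside? i v = any? λ w → (v H.~? w) ×-dec Above? i w

    Row? : ∀ i v → Dec (Row i v)
    Row? i v = Above? i v ⊎-dec ¬? (Beside? i v)

    Row-covers : ∀ i → H.Covers (Row i)
    Row-covers i v with Beside? i v
    ... | yes (w , v~w , a) = w , inj₁ a , inj₂ (H.~-sym v~w)
    ... | no ¬b             = v , inj₂ ¬b , inj₁ refl

    cost : H.Vertex → ℕ
    cost v = # (λ i → Row? i v)

    #Above≤col : ∀ v → # (λ i → Above? i v) ≤ col v
    #Above≤col v = #-image (λ x → D? x v) class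

    -- A class with no vertex of `D` in a neighbouring column must be dominated inside column `v`,
    -- so `#hidden≤` applies with the vertices of `D` in that column as `X`.
    #¬Beside≤col : ∀ v → # (λ i → ¬? (Beside? i v)) ≤ col v
    #¬Beside≤col v = G.StarPartition.#hidden≤ π (λ x → D? x v) (λ i → ¬? (Beside? i v)) hidden
      where
      hidden : ∀ y → (∃ λ x → D x v × y U.∈ G.N[ x ]) ⊎ ¬ ¬ Beside (class y) v
      hidden y with dominates y v
      ... | inj₁ d             = inj₁ d
      ... | inj₂ (w , d , v~w) = inj₂ λ ¬b → ¬b (w , v~w , y , d , refl)

    cost≤2col : ∀ v → cost v ≤ col v +ℕ col v
    cost≤2col v = begin
      cost v ≤⟨ sum-mono-≤ (λ i → χ-⊎ (Above? i v) (¬? (Beside? i v)) (Row? i v) id) ⟩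
      sum (λ i → χ (Above? i v) +ℕ χ (¬? (Beside? i v)))
        ≡⟨ ∑-distrib-+ (λ i → χ (Above? i v)) (λ i → χ (¬? (Beside? i v))) ⟩
      # (λ i → Above? i v) +ℕ # (λ i → ¬? (Beside? i v))
        ≤⟨ +-mono-≤ (#Above≤col v) (#¬Beside≤col v) ⟩
      col v +ℕ col v ∎
      where open ≤-Reasoning

    -- Let `x` be the only vertex of `D` in the column. By fairness every other class has a vertex
    -- outside `N[ x ]`, which must be dominated from a neighbouring column; that class is then
    -- `Beside` and not `Above`.
    cost-single : ∀ v → col v ≡ 1 → cost v ≤ 1
    cost-single v eq with #≡1⇒unique (λ x → D? x v) eq
    ... | x , dx , unique = #-unique (λ i → Row? i v) (class x) row⇒
      where
      row⇒ : ∀ {i} → Row i v → class x ≡ i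
      row⇒ (inj₁ (y , dy , refl)) = cong class (unique dy)
      row⇒ {i} (inj₂ ¬b) with i ≟ class x
      ... | yes eq = sym eq
      ... | no i≢ with fair x i i≢
      ...   | y , refl , y∉N with dominates y v
      ...     | inj₁ (z , dz , y∈N)   = contradiction (subst (λ z → y U.∈ G.N[ z ]) (sym (unique dz)) y∈N) y∉N
      ...     | inj₂ (w , dw , v~w)   = contradiction (w , v~w , y , dw , refl) ¬b

    cost≤γ : ∀ v → cost v ≤ γG
    cost≤γ v = ≤-trans (sum-mono-≤ λ i → χ≤1 (Row? i v)) (≤-reflexive (trans (sum-const γG 1) (*-identityʳ γG)))

    -- An empty column has cost zero by `cost≤2col`. This makes each `Row i` a competitor of `W`.
    Row⇒occupied : ∀ {i v} → Row i v → 1 ≤ col v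
    Row⇒occupied {i} {v} r with col v | cost≤2col v
    ... | zero  | le = contradiction (≤-trans (≤-reflexive (sym (χ-yes (Row? i v) r)))
                         (≤-trans (term≤sum (λ i → χ (Row? i v)) i) le)) λ ()
    ... | suc _ | _  = s≤s z≤n

  -- Here `cost` is at most `col`: for columns with at most one vertex by the bounds above, and for
  -- larger ones because there are at most two classes.
  γG≤2-bound : γG ≤ 2 → γG *ℕ γH ≤ ∣D∣
  γG≤2-bound γG≤2 = begin
    γG *ℕ γH                                   ≡⟨ sum-const γG γH ⟨
    sum {γG} (λ _ → γH)                        ≤⟨ sum-mono-≤ (λ i → H.γ≤# (R.Row? i) (R.Row-covers i)) ⟩
    sum (λ i → # (R.Row? i))                   ≡⟨ ∑-comm (λ i v → χ (R.Row? i v)) ⟩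
    sum R.cost                                 ≤⟨ sum-mono-≤ cost≤col ⟩
    ∣D∣                                        ∎
    where
    open ≤-Reasoning
    module R = Rows (proj₁ G.fairPartition) (proj₂ G.fairPartition)
    cost≤col : ∀ v → R.cost v ≤ col v
    cost≤col v with col v in eq | R.cost≤2col v
    ... | zero        | le = le
    ... | suc zero    | _  = R.cost-single v eq
    ... | suc (suc _) | _  = ≤-trans (R.cost≤γ v) (≤-trans γG≤2 (s≤s (s≤s z≤n)))

  -- The dominating set `W` of least weight, and the bound from the classes of `G`.

  -- The extra unit on single columns puts `singlesW` on the left of both main bounds. In their
  -- combination this offsets all but `γG * singlesW` of the loss in `label-bound`.
  weight : H.Vertex → ℕ
  weight v = suc γG +ℕ χ (single? v)

  wt : {P : Pred H.Vertex 0ℓ} → Decidable P → ℕ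
  wt P? = sum λ v → χ (P? v) *ℕ weight v

  -- Occupancy ensures that a column of `W` that is not single contains at least two vertices of
  -- `D`.
  Admissible : Subset H.order → Set
  Admissible T = (∀ v → v ∈ T → 1 ≤ col v) × H.Dominates T

  Admissible? : Decidable Admissible
  Admissible? T = (all? λ v → (v ∈? T) →-dec (1 ℕ.≤? col v)) ×-dec dominates? H T

  -- One fibre suffices: each of its vertices is dominated from its own column or from a
  -- neighbouring one, which is then occupied.
  supported : ∃ Admissible
  supported = subset (λ v → 1 ℕ.≤? col v)
            , (λ v → ∈-subset⁻ (λ v → 1 ℕ.≤? col v))
            , λ v → let w , 1≤ , v∈N = cover v in w , ∈-subset⁺ (λ v → 1 ℕ.≤? col v) 1≤ , v∈N
    where
    cover : H.Covers (λ v → 1 ≤ col v)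
    cover v with dominates (someVertex G) v
    ... | inj₁ (y , d , _)   = v , occupied d , inj₁ refl
    ... | inj₂ (w , d , v~w) = w , occupied d , inj₂ (H.~-sym v~w)

  minimal : ∃ λ W → Admissible W × (∀ T → Admissible T → wt (_∈? W) ≤ wt (_∈? T))
  minimal = argmin Admissible? (λ T → wt (_∈? T)) supported

  W : Subset H.order
  W = proj₁ minimal

  W? : ∀ v → Dec (v ∈ W)
  W? = _∈? W

  W-occupied : ∀ {v} → v ∈ W → 1 ≤ col v
  W-occupied {v} = proj₁ (proj₁ (proj₂ minimal)) v

  W-covers : H.Covers (_∈ W)
  W-covers = proj₂ (proj₁ (proj₂ minimal))

  wtW≤ : {P : Pred H.Vertex 0ℓ} (P? : Decidable P) → (∀ {v} → P v → 1 ≤ col v) → H.Covers P → wt W? ≤ wt P?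
  wtW≤ P? occ cov = ≤-trans
    (proj₂ (proj₂ minimal) (subset P?)
      ( (λ v v∈ → occ (∈-subset⁻ P? v∈))
      , λ x → let y , p , x∈N = cov x in y , ∈-subset⁺ P? p , x∈N))
    (sum-mono-≤ λ v → *-monoˡ-≤ (weight v) (χ-mono (v ∈? subset P?) (P? v) (∈-subset⁻ P?)))

  singles singlesW : ℕ
  singles  = # single?
  singlesW = # (λ v → W? v ×-dec single? v)

  singlesW≤singles : singlesW ≤ singles
  singlesW≤singles = #-mono (λ v → W? v ×-dec single? v) single? proj₂

  wtW≡ : wt W? ≡ # W? *ℕ suc γG +ℕ singlesW
  wtW≡ = begin
    wt W?
      ≡⟨ sum-cong-≗ (λ v → trans (*-distribˡ-+ (χ (W? v)) (suc γG) _) (cong (χ (W? v) *ℕ suc γG +ℕ_) (sym (χ-× (W? v) (single? v))))) ⟩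
    sum (λ v → χ (W? v) *ℕ suc γG +ℕ χ (W? v ×-dec single? v))
      ≡⟨ ∑-distrib-+ (λ v → χ (W? v) *ℕ suc γG) _ ⟩
    sum (λ v → χ (W? v) *ℕ suc γG) +ℕ singlesW
      ≡⟨ cong (_+ℕ singlesW) (sym (*-distribʳ-sum (suc γG) (λ v → χ (W? v)))) ⟩
    # W? *ℕ suc γG +ℕ singlesW ∎
    where open ≡-Reasoning

  γH≤#W : γH ≤ # W?
  γH≤#W = H.γ≤# W? W-covers

  -- `W` is compared with all `γG` rows, and the sum is taken by columns. A single column
  -- contributes at most (n+2) + n = 2(n+1), where n is `γG`; any other at most `2 * col v` times
  -- n+1.
  class-bound : γG *ℕ wt W? +ℕ γG *ℕ singles ≤ (2 *ℕ suc γG) *ℕ ∣D∣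
  class-bound = begin
    γG *ℕ wt W? +ℕ γG *ℕ singles
      ≡⟨ cong₂ _+ℕ_ (sym (sum-const γG (wt W?))) (*-distribˡ-sum γG (λ v → χ (single? v))) ⟩
    sum {γG} (λ _ → wt W?) +ℕ sum (λ v → γG *ℕ χ (single? v))
      ≤⟨ +-monoˡ-≤ _ (sum-mono-≤ λ i → wtW≤ (R.Row? i) R.Row⇒occupied (R.Row-covers i)) ⟩
    sum (λ i → wt (R.Row? i)) +ℕ sum (λ v → γG *ℕ χ (single? v))
      ≡⟨ cong (_+ℕ sum (λ v → γG *ℕ χ (single? v)))
           (trans (∑-comm (λ i v → χ (R.Row? i v) *ℕ weight v))
                  (sum-cong-≗ λ v → sym (*-distribʳ-sum (weight v) (λ i → χ (R.Row? i v))))) ⟩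
    sum (λ v → R.cost v *ℕ weight v) +ℕ sum (λ v → γG *ℕ χ (single? v))
      ≡⟨ ∑-distrib-+ (λ v → R.cost v *ℕ weight v) (λ v → γG *ℕ χ (single? v)) ⟨
    sum (λ v → R.cost v *ℕ weight v +ℕ γG *ℕ χ (single? v))
      ≤⟨ sum-mono-≤ local ⟩
    sum (λ v → (2 *ℕ suc γG) *ℕ col v)
      ≡⟨ *-distribˡ-sum (2 *ℕ suc γG) col ⟨
    (2 *ℕ suc γG) *ℕ ∣D∣ ∎
    where
    open ≤-Reasoning
    module R = Rows (proj₁ G.fairPartition) (proj₂ G.fairPartition)
    local : ∀ v → R.cost v *ℕ weight v +ℕ γG *ℕ χ (single? v) ≤ (2 *ℕ suc γG) *ℕ col v
    local v with single? v
    ... | yes eq = begin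
      R.cost v *ℕ (suc γG +ℕ 1) +ℕ γG *ℕ 1  ≤⟨ +-monoˡ-≤ (γG *ℕ 1) (*-monoˡ-≤ (suc γG +ℕ 1) (R.cost-single v eq)) ⟩
      1 *ℕ (suc γG +ℕ 1) +ℕ γG *ℕ 1         ≡⟨ one γG ⟩
      (2 *ℕ suc γG) *ℕ 1                    ≡⟨ cong ((2 *ℕ suc γG) *ℕ_) eq ⟨
      (2 *ℕ suc γG) *ℕ col v                ∎
      where
      one : ∀ g → 1 *ℕ (suc g +ℕ 1) +ℕ g *ℕ 1 ≡ (2 *ℕ suc g) *ℕ 1
      one = solve-∀
    ... | no _ = begin
      R.cost v *ℕ (suc γG +ℕ 0) +ℕ γG *ℕ 0           ≤⟨ +-monoˡ-≤ (γG *ℕ 0) (*-monoˡ-≤ (suc γG +ℕ 0) (R.cost≤2col v)) ⟩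
      (col v +ℕ col v) *ℕ (suc γG +ℕ 0) +ℕ γG *ℕ 0   ≡⟨ two (col v) γG ⟩
      (2 *ℕ suc γG) *ℕ col v                         ∎
      where
      two : ∀ d g → (d +ℕ d) *ℕ (suc g +ℕ 0) +ℕ g *ℕ 0 ≡ (2 *ℕ suc g) *ℕ d
      two = solve-∀

  -- Stars of `H` centred at `W`, and the bound from them.

  φ : H.Vertex → H.Vertex
  φ v with W? v
  -- Members of `W` are fixed even if `W-covers` would choose a neighbour; the exchange in
  -- `missed-weight` depends on this.
  ... | yes _ = v
  ... | no _  = proj₁ (W-covers v)

  φ∈W : ∀ v → φ v ∈ W
  φ∈W v with W? v
  ... | yes v∈W = v∈W
  ... | no _    = proj₁ (proj₂ (W-covers v))

  φ-near : ∀ v → v U.∈ H.N[ φ v ]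
  φ-near v with W? v
  ... | yes _ = inj₁ refl
  ... | no _  = proj₂ (proj₂ (W-covers v))

  φ-fixes : ∀ {v} → v ∈ W → φ v ≡ v
  φ-fixes {v} v∈W with W? v
  ... | yes _   = refl
  ... | no v∉W = contradiction v∈W v∉W

  -- `Hit w` projects to `G` the part of `D` over the star of `w`. If `x` is not `Near w`, then
  -- every vertex of that star in the fibre over `x` is dominated along `H`.
  Hit Near : H.Vertex → Pred G.Vertex 0ℓ
  Hit  w x = ∃ λ v → D x v × φ v ≡ w
  Near w x = ∃ λ y → Hit w y × x U.∈ G.N[ y ]

  Hit? : ∀ w x → Dec (Hit w x)
  Hit? w x = any? λ v → D? x v ×-dec (φ v ≟ w)

  Near? : ∀ w x → Dec (Near w x)
  Near? w x = any? λ y → Hit? w y ×-dec G.N? y x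

  Missed? : ∀ w x → Dec (¬ Near w x)
  Missed? w x = ¬? (Near? w x)

  γG≤hit+missed : ∀ w → γG ≤ sum (λ x → χ (Hit? w x) +ℕ χ (Missed? w x))
  γG≤hit+missed w = ≤-trans (G.γ≤# U? cover) (sum-mono-≤ λ x → χ-⊎ (Hit? w x) (Missed? w x) (U? x) id)
    where
    U? = λ x → Hit? w x ⊎-dec Missed? w x
    cover : G.Covers (λ x → Hit w x ⊎ ¬ Near w x)
    cover x with Near? w x
    ... | yes (y , h , x∈N) = y , inj₁ h , x∈N
    ... | no ¬near          = x , inj₂ ¬near , inj₁ refl

  -- Each hit is charged to some `v` with `D x v` and `φ v ≡ w`; such a `v` pays for one star only,
  -- that of `φ v`.
  hit-weight : ∀ x → sum (λ w → χ (W? w) *ℕ weight w *ℕ χ (Hit? w x)) ≤ sum (λ v → χ (D? x v) *ℕ weight (φ v))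
  hit-weight x = begin
    sum (λ w → χ (W? w) *ℕ weight w *ℕ χ (Hit? w x))
      ≤⟨ sum-mono-≤ (λ w → *-mono-≤ (≤-trans (*-monoˡ-≤ (weight w) (χ≤1 (W? w))) (≤-reflexive (*-identityˡ (weight w))))
                                    (χ-∃ (λ v → D? x v ×-dec (φ v ≟ w)) (Hit? w x))) ⟩
    sum (λ w → weight w *ℕ sum (λ v → χ (D? x v ×-dec (φ v ≟ w))))
      ≡⟨ sum-cong-≗ (λ w → *-distribˡ-sum (weight w) (λ v → χ (D? x v ×-dec (φ v ≟ w)))) ⟩
    sum (λ w → sum λ v → weight w *ℕ χ (D? x v ×-dec (φ v ≟ w)))
      ≡⟨ ∑-comm (λ w v → weight w *ℕ χ (D? x v ×-dec (φ v ≟ w))) ⟩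
    sum (λ v → sum λ w → weight w *ℕ χ (D? x v ×-dec (φ v ≟ w)))
      ≡⟨ sum-cong-≗ (λ v → sum-cong-≗ λ w → trans (cong (weight w *ℕ_) (χ-× (D? x v) (φ v ≟ w)))
                                                  (swap (weight w) (χ (D? x v)) (χ (φ v ≟ w)))) ⟩
    sum (λ v → sum λ w → χ (D? x v) *ℕ (χ (φ v ≟ w) *ℕ weight w))
      ≡⟨ sum-cong-≗ (λ v → trans (sym (*-distribˡ-sum (χ (D? x v)) (λ w → χ (φ v ≟ w) *ℕ weight w)))
                                 (cong (χ (D? x v) *ℕ_) (sum-χ≟ (φ v) weight))) ⟩
    sum (λ v → χ (D? x v) *ℕ weight (φ v)) ∎
    where
    open ≤-Reasoning
    swap : ∀ a b c → a *ℕ (b *ℕ c) ≡ b *ℕ (c *ℕ a)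
    swap = solve-∀

  -- Exchanging the missed vertices of W for the vertices of D in the fibre
  -- over x gives an admissible set again, which W does not outweigh.
  missed-weight : ∀ x → sum (λ w → χ (W? w) *ℕ weight w *ℕ χ (Missed? w x)) ≤
                        sum (λ v → χ (D? x v) *ℕ (χ (¬? (W? v)) *ℕ weight v))
  missed-weight x = +-cancelˡ-≤ (wt W?) _ _ (begin
    wt W? +ℕ sum (λ w → χ (W? w) *ℕ weight w *ℕ χ (Missed? w x))
      ≤⟨ +-monoˡ-≤ _ (wtW≤ T? T-occupied T-covers) ⟩
    wt T? +ℕ sum (λ w → χ (W? w) *ℕ weight w *ℕ χ (Missed? w x))
      ≡⟨ ∑-distrib-+ (λ w → χ (T? w) *ℕ weight w) (λ w → χ (W? w) *ℕ weight w *ℕ χ (Missed? w x)) ⟨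
    sum (λ v → χ (T? v) *ℕ weight v +ℕ χ (W? v) *ℕ weight v *ℕ χ (Missed? v x))
      ≤⟨ sum-mono-≤ local ⟩
    sum (λ v → χ (W? v) *ℕ weight v +ℕ χ (D? x v) *ℕ (χ (¬? (W? v)) *ℕ weight v))
      ≡⟨ ∑-distrib-+ (λ v → χ (W? v) *ℕ weight v) (λ v → χ (D? x v) *ℕ (χ (¬? (W? v)) *ℕ weight v)) ⟩
    wt W? +ℕ sum (λ v → χ (D? x v) *ℕ (χ (¬? (W? v)) *ℕ weight v)) ∎)
    where
    open ≤-Reasoning
    T : Pred H.Vertex 0ℓ
    T v = D x v ⊎ v ∈ W × Near v x
    T? : ∀ v → Dec (T v)
    T? v = D? x v ⊎-dec (W? v ×-dec Near? v x)
    T-occupied : ∀ {v} → T v → 1 ≤ col v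
    T-occupied (inj₁ d)         = occupied d
    T-occupied (inj₂ (v∈W , _)) = W-occupied v∈W
    T-covers : H.Covers T
    T-covers v with dominates x v
    -- Domination within column `v` puts `x` near `φ v`, so this centre was kept.
    ... | inj₁ (y , d , x∈N) = φ v , inj₂ (φ∈W v , y , (v , d , refl) , x∈N) , φ-near v
    ... | inj₂ (w , d , v~w) = w , inj₁ d , inj₂ (H.~-sym v~w)
    hit⇒near : ∀ {v} → v ∈ W → D x v → Near v x
    hit⇒near v∈W d = x , (_ , d , φ-fixes v∈W) , inj₁ refl
    local : ∀ v → χ (T? v) *ℕ weight v +ℕ χ (W? v) *ℕ weight v *ℕ χ (Missed? v x)
                ≤ χ (W? v) *ℕ weight v +ℕ χ (D? x v) *ℕ (χ (¬? (W? v)) *ℕ weight v)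
    local v with weight v
    ... | c with D? x v | W? v | Near? v x
    -- A column of `W` in which `D` contains `x` belongs to its own star, so `x` itself is a hit
    -- there.
    ...   | yes d | yes v∈W | no ¬near = contradiction (hit⇒near v∈W d) ¬near
    ...   | yes _ | yes _   | yes _    = ≤-reflexive (e c)
      where
      e : ∀ c → 1 *ℕ c +ℕ 1 *ℕ c *ℕ 0 ≡ 1 *ℕ c +ℕ 1 *ℕ (0 *ℕ c)
      e = solve-∀
    ...   | yes _ | no _    | _        = ≤-reflexive (e c)
      where
      e : ∀ c → 1 *ℕ c +ℕ 0 ≡ 0 *ℕ c +ℕ 1 *ℕ (1 *ℕ c)
      e = solve-∀
    ...   | no _  | yes _   | yes _    = ≤-reflexive (e c)
      where
      e : ∀ c → 1 *ℕ c +ℕ 1 *ℕ c *ℕ 0 ≡ 1 *ℕ c +ℕ 0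
      e = solve-∀
    ...   | no _  | yes _   | no _     = ≤-reflexive (e c)
      where
      e : ∀ c → 0 +ℕ 1 *ℕ c *ℕ 1 ≡ 1 *ℕ c +ℕ 0
      e = solve-∀
    ...   | no _  | no _    | _        = z≤n

  weight≤ : ∀ v → weight v ≤ γG +ℕ 2
  weight≤ v = ≤-trans (+-monoʳ-≤ (suc γG) (χ≤1 (single? v))) (≤-reflexive (sym (+-suc γG 1)))

  -- For each `w` in `W`, the hit and missed vertices together dominate `G`. Summing with weights
  -- charges every vertex of `D` by its column. Columns of `W` escape the missed charge; the slack
  -- pays for the term `2 * (γG + 2)` per column of `W`.
  label-bound : γG *ℕ wt W? +ℕ 2 *ℕ (γG +ℕ 2) *ℕ # W? ≤
                (2 *ℕ γG +ℕ 3) *ℕ ∣D∣ +ℕ (singles +ℕ (γG +ℕ 2) *ℕ singlesW)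
  label-bound = begin
    γG *ℕ wt W? +ℕ a *ℕ # W?
      ≡⟨ cong (_+ℕ a *ℕ # W?) (trans (*-comm γG (wt W?)) (*-distribʳ-sum γG (λ w → χ (W? w) *ℕ weight w))) ⟩
    sum (λ w → χ (W? w) *ℕ weight w *ℕ γG) +ℕ a *ℕ # W?
      ≤⟨ +-monoˡ-≤ (a *ℕ # W?) (sum-mono-≤ λ w → *-monoʳ-≤ (χ (W? w) *ℕ weight w) (γG≤hit+missed w)) ⟩
    sum (λ w → χ (W? w) *ℕ weight w *ℕ sum (λ x → χ (Hit? w x) +ℕ χ (Missed? w x))) +ℕ a *ℕ # W?
      ≡⟨ cong (_+ℕ a *ℕ # W?) (trans
           (sum-cong-≗ λ w → *-distribˡ-sum (χ (W? w) *ℕ weight w) (λ x → χ (Hit? w x) +ℕ χ (Missed? w x)))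
           (∑-comm λ w x → χ (W? w) *ℕ weight w *ℕ (χ (Hit? w x) +ℕ χ (Missed? w x)))) ⟩
    sum (λ x → sum λ w → χ (W? w) *ℕ weight w *ℕ (χ (Hit? w x) +ℕ χ (Missed? w x))) +ℕ a *ℕ # W?
      ≤⟨ +-monoˡ-≤ (a *ℕ # W?) (sum-mono-≤ fibre) ⟩
    sum (λ x → sum λ v → χ (D? x v) *ℕ charge v) +ℕ a *ℕ # W?
      ≡⟨ cong₂ _+ℕ_ (trans (∑-comm λ x v → χ (D? x v) *ℕ charge v)
                           (sum-cong-≗ λ v → sym (*-distribʳ-sum (charge v) (λ x → χ (D? x v)))))
                    (*-distribˡ-sum a (λ v → χ (W? v))) ⟩
    sum (λ v → col v *ℕ charge v) +ℕ sum (λ v → a *ℕ χ (W? v))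
      ≡⟨ ∑-distrib-+ (λ v → col v *ℕ charge v) (λ v → a *ℕ χ (W? v)) ⟨
    sum (λ v → col v *ℕ charge v +ℕ a *ℕ χ (W? v))
      ≤⟨ sum-mono-≤ local ⟩
    sum (λ v → b *ℕ col v +ℕ (χ (single? v) +ℕ (γG +ℕ 2) *ℕ χ (W? v ×-dec single? v)))
      ≡⟨ trans (∑-distrib-+ (λ v → b *ℕ col v) (λ v → χ (single? v) +ℕ (γG +ℕ 2) *ℕ χ (W? v ×-dec single? v)))
               (cong (sum (λ v → b *ℕ col v) +ℕ_)
                 (∑-distrib-+ (λ v → χ (single? v)) (λ v → (γG +ℕ 2) *ℕ χ (W? v ×-dec single? v)))) ⟩
    sum (λ v → b *ℕ col v) +ℕ (singles +ℕ sum (λ v → (γG +ℕ 2) *ℕ χ (W? v ×-dec single? v)))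
      ≡⟨ cong₂ (λ p q → p +ℕ (singles +ℕ q)) (*-distribˡ-sum b col)
               (*-distribˡ-sum (γG +ℕ 2) (λ v → χ (W? v ×-dec single? v))) ⟨
    b *ℕ ∣D∣ +ℕ (singles +ℕ (γG +ℕ 2) *ℕ singlesW) ∎
    where
    open ≤-Reasoning
    a b : ℕ
    a = 2 *ℕ (γG +ℕ 2)
    b = 2 *ℕ γG +ℕ 3

    charge : H.Vertex → ℕ
    charge v = weight (φ v) +ℕ χ (¬? (W? v)) *ℕ weight v

    fibre : ∀ x → sum (λ w → χ (W? w) *ℕ weight w *ℕ (χ (Hit? w x) +ℕ χ (Missed? w x))) ≤
                  sum (λ v → χ (D? x v) *ℕ charge v)
    fibre x = begin
      sum (λ w → χ (W? w) *ℕ weight w *ℕ (χ (Hit? w x) +ℕ χ (Missed? w x)))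
        ≡⟨ trans (sum-cong-≗ λ w → *-distribˡ-+ (χ (W? w) *ℕ weight w) (χ (Hit? w x)) (χ (Missed? w x)))
                 (∑-distrib-+ (λ w → χ (W? w) *ℕ weight w *ℕ χ (Hit? w x)) _) ⟩
      sum (λ w → χ (W? w) *ℕ weight w *ℕ χ (Hit? w x)) +ℕ sum (λ w → χ (W? w) *ℕ weight w *ℕ χ (Missed? w x))
        ≤⟨ +-mono-≤ (hit-weight x) (missed-weight x) ⟩
      sum (λ v → χ (D? x v) *ℕ weight (φ v)) +ℕ sum (λ v → χ (D? x v) *ℕ (χ (¬? (W? v)) *ℕ weight v))
        ≡⟨ trans (sum-cong-≗ λ v → *-distribˡ-+ (χ (D? x v)) (weight (φ v)) (χ (¬? (W? v)) *ℕ weight v))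
                 (∑-distrib-+ (λ v → χ (D? x v) *ℕ weight (φ v)) _) ⟨
      sum (λ v → χ (D? x v) *ℕ charge v) ∎

    local : ∀ v → col v *ℕ charge v +ℕ a *ℕ χ (W? v) ≤
                  b *ℕ col v +ℕ (χ (single? v) +ℕ (γG +ℕ 2) *ℕ χ (W? v ×-dec single? v))
    local v with W? v
    ... | no _ = begin
      col v *ℕ (weight (proj₁ (W-covers v)) +ℕ 1 *ℕ weight v) +ℕ a *ℕ 0
        ≤⟨ +-monoˡ-≤ (a *ℕ 0) (*-monoʳ-≤ (col v) (+-monoˡ-≤ (1 *ℕ weight v) (weight≤ (proj₁ (W-covers v))))) ⟩
      col v *ℕ (γG +ℕ 2 +ℕ 1 *ℕ weight v) +ℕ a *ℕ 0
        ≡⟨ expand (col v) γG (χ (single? v)) ⟩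
      -- Only a single column exceeds `b * col v`, and then by exactly one since `col v` is 1.
      b *ℕ col v +ℕ (col v *ℕ χ (single? v) +ℕ (γG +ℕ 2) *ℕ 0)
        ≡⟨ cong (λ p → b *ℕ col v +ℕ (p +ℕ (γG +ℕ 2) *ℕ 0)) col*χ ⟩
      b *ℕ col v +ℕ (χ (single? v) +ℕ (γG +ℕ 2) *ℕ 0) ∎
      where
      expand : ∀ d g s → d *ℕ (g +ℕ 2 +ℕ 1 *ℕ (suc g +ℕ s)) +ℕ 2 *ℕ (g +ℕ 2) *ℕ 0 ≡
                         (2 *ℕ g +ℕ 3) *ℕ d +ℕ (d *ℕ s +ℕ (g +ℕ 2) *ℕ 0)
      expand = solve-∀
      col*χ : col v *ℕ χ (single? v) ≡ χ (single? v)
      col*χ with single? v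
      ... | yes eq = trans (*-identityʳ (col v)) eq
      ... | no _   = *-zeroʳ (col v)
    ... | yes v∈W with single? v
    ...   | yes eq = begin
      col v *ℕ (suc γG +ℕ 1 +ℕ 0) +ℕ a *ℕ 1    ≡⟨ cong (λ d → d *ℕ (suc γG +ℕ 1 +ℕ 0) +ℕ a *ℕ 1) eq ⟩
      1 *ℕ (suc γG +ℕ 1 +ℕ 0) +ℕ a *ℕ 1        ≡⟨ expand γG ⟩
      b *ℕ 1 +ℕ (1 +ℕ (γG +ℕ 2) *ℕ 1)          ≡⟨ cong (λ d → b *ℕ d +ℕ (1 +ℕ (γG +ℕ 2) *ℕ 1)) eq ⟨
      b *ℕ col v +ℕ (1 +ℕ (γG +ℕ 2) *ℕ 1)      ∎
      where
      expand : ∀ g → 1 *ℕ (suc g +ℕ 1 +ℕ 0) +ℕ 2 *ℕ (g +ℕ 2) *ℕ 1 ≡ (2 *ℕ g +ℕ 3) *ℕ 1 +ℕ (1 +ℕ (g +ℕ 2) *ℕ 1)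
      expand = solve-∀
    ...   | no ≢1 = begin
      col v *ℕ (suc γG +ℕ 0 +ℕ 0) +ℕ a *ℕ 1        ≡⟨ expand (col v) γG ⟩
      col v *ℕ suc γG +ℕ (γG +ℕ 2) *ℕ 2            ≤⟨ +-monoʳ-≤ (col v *ℕ suc γG) (*-monoʳ-≤ (γG +ℕ 2) 2≤col) ⟩
      col v *ℕ suc γG +ℕ (γG +ℕ 2) *ℕ col v        ≡⟨ collect (col v) γG ⟩
      b *ℕ col v +ℕ (0 +ℕ (γG +ℕ 2) *ℕ 0)          ∎
      where
      -- Admissibility excludes 0 and the present case excludes 1.
      2≤col : 2 ≤ col v
      2≤col = ≤∧≢⇒< (W-occupied v∈W) (≢1 ∘ sym)
      expand : ∀ d g → d *ℕ (suc g +ℕ 0 +ℕ 0) +ℕ 2 *ℕ (g +ℕ 2) *ℕ 1 ≡ d *ℕ suc g +ℕ (g +ℕ 2) *ℕ 2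
      expand = solve-∀
      collect : ∀ d g → d *ℕ suc g +ℕ (g +ℕ 2) *ℕ d ≡ (2 *ℕ g +ℕ 3) *ℕ d +ℕ (0 +ℕ (g +ℕ 2) *ℕ 0)
      collect = solve-∀

  combined-bound : Combined γG γH ∣D∣
  combined-bound = ≤-trans (*-monoʳ-≤ (γG *ℕ (2 *ℕ γG *ℕ γG +ℕ 9 *ℕ γG +ℕ 11)) γH≤#W)
    (combine-≤ γG (# W?) singlesW singles ∣D∣
      (subst (λ c → γG *ℕ c +ℕ γG *ℕ singles ≤ 2 *ℕ suc γG *ℕ ∣D∣) wtW≡ class-bound)
      (subst (λ c → γG *ℕ c +ℕ 2 *ℕ (γG +ℕ 2) *ℕ # W? ≤ (2 *ℕ γG +ℕ 3) *ℕ ∣D∣ +ℕ (singles +ℕ (γG +ℕ 2) *ℕ singlesW)) wtW≡ label-bound)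
      singlesW≤singles)
    where
    -- With multipliers 3 and 2g, the coefficient of `a` is 2g²+3g on the left and 2g²+4g on the
    -- right, that of `q` is 3g and 2g. The spare g on each side is settled by `a ≤ q`.
    combine-≤ : ∀ g w a q d →
      g *ℕ (w *ℕ suc g +ℕ a) +ℕ g *ℕ q ≤ 2 *ℕ suc g *ℕ d →
      g *ℕ (w *ℕ suc g +ℕ a) +ℕ 2 *ℕ (g +ℕ 2) *ℕ w ≤ (2 *ℕ g +ℕ 3) *ℕ d +ℕ (q +ℕ (g +ℕ 2) *ℕ a) →
      a ≤ q →
      g *ℕ (2 *ℕ g *ℕ g +ℕ 9 *ℕ g +ℕ 11) *ℕ w ≤ (4 *ℕ g *ℕ g +ℕ 12 *ℕ g +ℕ 6) *ℕ d
    combine-≤ g w a q d p₁ p₂ a≤q = +-cancelʳ-≤ (3 *ℕ g *ℕ q +ℕ (3 *ℕ g *ℕ a +ℕ 2 *ℕ g *ℕ g *ℕ a)) _ _ (begin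
      g *ℕ (2 *ℕ g *ℕ g +ℕ 9 *ℕ g +ℕ 11) *ℕ w +ℕ (3 *ℕ g *ℕ q +ℕ (3 *ℕ g *ℕ a +ℕ 2 *ℕ g *ℕ g *ℕ a))
        ≡⟨ left g w a q ⟩
      3 *ℕ (g *ℕ (w *ℕ suc g +ℕ a) +ℕ g *ℕ q) +ℕ 2 *ℕ g *ℕ (g *ℕ (w *ℕ suc g +ℕ a) +ℕ 2 *ℕ (g +ℕ 2) *ℕ w)
        ≤⟨ +-mono-≤ (*-monoʳ-≤ 3 p₁) (*-monoʳ-≤ (2 *ℕ g) p₂) ⟩
      3 *ℕ (2 *ℕ suc g *ℕ d) +ℕ 2 *ℕ g *ℕ ((2 *ℕ g +ℕ 3) *ℕ d +ℕ (q +ℕ (g +ℕ 2) *ℕ a))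
        ≡⟨ right g a q d ⟩
      (4 *ℕ g *ℕ g +ℕ 12 *ℕ g +ℕ 6) *ℕ d +ℕ (2 *ℕ g *ℕ q +ℕ (3 *ℕ g *ℕ a +ℕ 2 *ℕ g *ℕ g *ℕ a)) +ℕ g *ℕ a
        ≤⟨ +-monoʳ-≤ _ (*-monoʳ-≤ g a≤q) ⟩
      (4 *ℕ g *ℕ g +ℕ 12 *ℕ g +ℕ 6) *ℕ d +ℕ (2 *ℕ g *ℕ q +ℕ (3 *ℕ g *ℕ a +ℕ 2 *ℕ g *ℕ g *ℕ a)) +ℕ g *ℕ q
        ≡⟨ regroup g a q ((4 *ℕ g *ℕ g +ℕ 12 *ℕ g +ℕ 6) *ℕ d) ⟩
      (4 *ℕ g *ℕ g +ℕ 12 *ℕ g +ℕ 6) *ℕ d +ℕ (3 *ℕ g *ℕ q +ℕ (3 *ℕ g *ℕ a +ℕ 2 *ℕ g *ℕ g *ℕ a)) ∎)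
      where
      open ≤-Reasoning
      left : ∀ g w a q →
        g *ℕ (2 *ℕ g *ℕ g +ℕ 9 *ℕ g +ℕ 11) *ℕ w +ℕ (3 *ℕ g *ℕ q +ℕ (3 *ℕ g *ℕ a +ℕ 2 *ℕ g *ℕ g *ℕ a)) ≡
        3 *ℕ (g *ℕ (w *ℕ suc g +ℕ a) +ℕ g *ℕ q) +ℕ 2 *ℕ g *ℕ (g *ℕ (w *ℕ suc g +ℕ a) +ℕ 2 *ℕ (g +ℕ 2) *ℕ w)
      left = solve-∀
      right : ∀ g a q d →
        3 *ℕ (2 *ℕ suc g *ℕ d) +ℕ 2 *ℕ g *ℕ ((2 *ℕ g +ℕ 3) *ℕ d +ℕ (q +ℕ (g +ℕ 2) *ℕ a)) ≡
        (4 *ℕ g *ℕ g +ℕ 12 *ℕ g +ℕ 6) *ℕ d +ℕ (2 *ℕ g *ℕ q +ℕ (3 *ℕ g *ℕ a +ℕ 2 *ℕ g *ℕ g *ℕ a)) +ℕ g *ℕ a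
      right = solve-∀
      regroup : ∀ g a q c →
        c +ℕ (2 *ℕ g *ℕ q +ℕ (3 *ℕ g *ℕ a +ℕ 2 *ℕ g *ℕ g *ℕ a)) +ℕ g *ℕ q ≡
        c +ℕ (3 *ℕ g *ℕ q +ℕ (3 *ℕ g *ℕ a +ℕ 2 *ℕ g *ℕ g *ℕ a))
      regroup = solve-∀

-- Clearing denominators, and the arithmetic for odd and even γ(G).

fraction-≥ : ∀ a b g h d .{{_ : NonZero b}} → a *ℕ g *ℕ h ≤ d *ℕ b →
             (+ d / 1) ≥ (+ a / b) * (+ g / 1) * (+ h / 1)
fraction-≥ a (suc b) g h d le = ℚ.toℚᵘ-cancel-≤ (begin
  toℚᵘ ((+ a / suc b) * (+ g / 1) * (+ h / 1))
    ≃⟨ ℚ.toℚᵘ-homo-* ((+ a / suc b) * (+ g / 1)) (+ h / 1) ⟩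
  toℚᵘ ((+ a / suc b) * (+ g / 1)) *ᵘ toℚᵘ (+ h / 1)
    ≃⟨ ℚᵘ.*-cong (ℚ.toℚᵘ-homo-* (+ a / suc b) (+ g / 1)) (ℚ.toℚᵘ-fromℚᵘ (mkℚᵘ (+ h) 0)) ⟩
  toℚᵘ (+ a / suc b) *ᵘ toℚᵘ (+ g / 1) *ᵘ mkℚᵘ (+ h) 0
    ≃⟨ ℚᵘ.*-congʳ (ℚᵘ.*-cong (ℚ.toℚᵘ-fromℚᵘ (mkℚᵘ (+ a) b)) (ℚ.toℚᵘ-fromℚᵘ (mkℚᵘ (+ g) 0))) ⟩
  mkℚᵘ (+ a) b *ᵘ mkℚᵘ (+ g) 0 *ᵘ mkℚᵘ (+ h) 0
    ≤⟨ *≤* cross ⟩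
  mkℚᵘ (+ d) 0
    ≃⟨ ℚ.toℚᵘ-fromℚᵘ (mkℚᵘ (+ d) 0) ⟨
  toℚᵘ (+ d / 1) ∎)
  where
  open ℚᵘ.≤-Reasoning
  cross : (+ a ℤ.* + g ℤ.* + h) ℤ.* + 1 ℤ.≤ + d ℤ.* + (suc b *ℕ 1 *ℕ 1)
  cross rewrite sym (ℤ.pos-* a g) | sym (ℤ.pos-* (a *ℕ g) h) | ℤ.*-identityʳ (+ (a *ℕ g *ℕ h))
              | *-identityʳ (suc b *ℕ 1) | *-identityʳ (suc b) | sym (ℤ.pos-* d (suc b)) = ℤ.+≤+ le

parity : ∀ n → 2 ∣ n ⊎ ∃ λ j → n ≡ suc (2 *ℕ j)
parity zero = inj₁ (divides 0 refl)
parity (suc n) with parity n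
... | inj₁ (divides j eq) = inj₂ (j , cong suc (trans eq (*-comm j 2)))
... | inj₂ (j , eq)       = inj₁ (divides (suc j) (cong suc (trans eq (cong suc (*-comm 2 j)))))

⌈odd/2⌉ : ∀ j → ⌈ suc (2 *ℕ j) /2⌉ ≡ suc j
⌈odd/2⌉ zero    = refl
⌈odd/2⌉ (suc j) = trans (cong (λ k → ⌈ suc k /2⌉) (*-suc 2 j)) (cong suc (⌈odd/2⌉ j))

-- With n = k+1 the cancelled factor is 4n²+12n+6. The discarded term is 2(n-1)(n+3) times `m`, the
-- difference of 2n(2n²+9n+11) and (n+1)(4n²+12n+6).
odd-bound : ∀ k m d → Combined (suc k) m d → (2 +ℕ k) *ℕ m ≤ 2 *ℕ d
odd-bound k m d le = *-cancelˡ-≤ (22 +ℕ (20 *ℕ k +ℕ 4 *ℕ k *ℕ k)) (begin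
  (22 +ℕ (20 *ℕ k +ℕ 4 *ℕ k *ℕ k)) *ℕ ((2 +ℕ k) *ℕ m)
    ≤⟨ m≤m+n _ (2 *ℕ k *ℕ k *ℕ m +ℕ 8 *ℕ k *ℕ m) ⟩
  (22 +ℕ (20 *ℕ k +ℕ 4 *ℕ k *ℕ k)) *ℕ ((2 +ℕ k) *ℕ m) +ℕ (2 *ℕ k *ℕ k *ℕ m +ℕ 8 *ℕ k *ℕ m)
    ≡⟨ left k m ⟩
  2 *ℕ (suc k *ℕ (2 *ℕ suc k *ℕ suc k +ℕ 9 *ℕ suc k +ℕ 11) *ℕ m)
    ≤⟨ *-monoʳ-≤ 2 le ⟩
  2 *ℕ ((4 *ℕ suc k *ℕ suc k +ℕ 12 *ℕ suc k +ℕ 6) *ℕ d)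
    ≡⟨ right k d ⟩
  (22 +ℕ (20 *ℕ k +ℕ 4 *ℕ k *ℕ k)) *ℕ (2 *ℕ d) ∎)
  where
  open ≤-Reasoning
  left : ∀ k m → (22 +ℕ (20 *ℕ k +ℕ 4 *ℕ k *ℕ k)) *ℕ ((2 +ℕ k) *ℕ m) +ℕ (2 *ℕ k *ℕ k *ℕ m +ℕ 8 *ℕ k *ℕ m) ≡
                 2 *ℕ (suc k *ℕ (2 *ℕ suc k *ℕ suc k +ℕ 9 *ℕ suc k +ℕ 11) *ℕ m)
  left = solve-∀
  right : ∀ k d → 2 *ℕ ((4 *ℕ suc k *ℕ suc k +ℕ 12 *ℕ suc k +ℕ 6) *ℕ d) ≡ (22 +ℕ (20 *ℕ k +ℕ 4 *ℕ k *ℕ k)) *ℕ (2 *ℕ d)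
  right = solve-∀

-- With n = k+4 the cancelled factor is again 4n²+12n+6. The discarded term is n(2n²-2n-22) times
-- `m`, which is nonnegative from n = 4 on but not for n = 2.
even-bound : ∀ k m d → Combined (4 +ℕ k) m d → (4 +ℕ k) *ℕ (4 +ℕ k) *ℕ m ≤ d *ℕ (6 +ℕ 2 *ℕ k)
even-bound k m d le = *-cancelˡ-≤ (118 +ℕ (44 *ℕ k +ℕ 4 *ℕ k *ℕ k)) (begin
  (118 +ℕ (44 *ℕ k +ℕ 4 *ℕ k *ℕ k)) *ℕ ((4 +ℕ k) *ℕ (4 +ℕ k) *ℕ m)
    ≤⟨ m≤m+n _ ((4 +ℕ k) *ℕ m *ℕ (2 *ℕ k *ℕ k +ℕ 14 *ℕ k +ℕ 2)) ⟩
  (118 +ℕ (44 *ℕ k +ℕ 4 *ℕ k *ℕ k)) *ℕ ((4 +ℕ k) *ℕ (4 +ℕ k) *ℕ m) +ℕ (4 +ℕ k) *ℕ m *ℕ (2 *ℕ k *ℕ k +ℕ 14 *ℕ k +ℕ 2)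
    ≡⟨ left k m ⟩
  (6 +ℕ 2 *ℕ k) *ℕ ((4 +ℕ k) *ℕ (2 *ℕ (4 +ℕ k) *ℕ (4 +ℕ k) +ℕ 9 *ℕ (4 +ℕ k) +ℕ 11) *ℕ m)
    ≤⟨ *-monoʳ-≤ (6 +ℕ 2 *ℕ k) le ⟩
  (6 +ℕ 2 *ℕ k) *ℕ ((4 *ℕ (4 +ℕ k) *ℕ (4 +ℕ k) +ℕ 12 *ℕ (4 +ℕ k) +ℕ 6) *ℕ d)
    ≡⟨ right k d ⟩
  (118 +ℕ (44 *ℕ k +ℕ 4 *ℕ k *ℕ k)) *ℕ (d *ℕ (6 +ℕ 2 *ℕ k)) ∎)
  where
  open ≤-Reasoning
  left : ∀ k m →
    (118 +ℕ (44 *ℕ k +ℕ 4 *ℕ k *ℕ k)) *ℕ ((4 +ℕ k) *ℕ (4 +ℕ k) *ℕ m) +ℕ (4 +ℕ k) *ℕ m *ℕ (2 *ℕ k *ℕ k +ℕ 14 *ℕ k +ℕ 2) ≡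
    (6 +ℕ 2 *ℕ k) *ℕ ((4 +ℕ k) *ℕ (2 *ℕ (4 +ℕ k) *ℕ (4 +ℕ k) +ℕ 9 *ℕ (4 +ℕ k) +ℕ 11) *ℕ m)
  left = solve-∀
  right : ∀ k d →
    (6 +ℕ 2 *ℕ k) *ℕ ((4 *ℕ (4 +ℕ k) *ℕ (4 +ℕ k) +ℕ 12 *ℕ (4 +ℕ k) +ℕ 6) *ℕ d) ≡
    (118 +ℕ (44 *ℕ k +ℕ 4 *ℕ k *ℕ k)) *ℕ (d *ℕ (6 +ℕ 2 *ℕ k))
  right = solve-∀

-- For odd `g` the denominator equals `g` and cancels, leaving (g+1)m ≤ 2d.
odd-numerics : ∀ g {m d} → ¬ 2 ∣ g → Combined g m d → ⌈ g /2⌉ *ℕ g *ℕ m ≤ d *ℕ (2 *ℕ ⌈ g /2⌉ ∸ℕ 1)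
odd-numerics g {m} {d} ¬even le with parity g
... | inj₁ even       = contradiction even ¬even
... | inj₂ (j , refl) = subst (λ c → c *ℕ suc (2 *ℕ j) *ℕ m ≤ d *ℕ (2 *ℕ c ∸ℕ 1)) (sym (⌈odd/2⌉ j)) (begin
  suc j *ℕ suc (2 *ℕ j) *ℕ m              ≡⟨ swap (suc j) (suc (2 *ℕ j)) m ⟩
  suc j *ℕ m *ℕ suc (2 *ℕ j)              ≤⟨ *-monoˡ-≤ (suc (2 *ℕ j)) halved ⟩
  d *ℕ suc (2 *ℕ j)                       ≡⟨ cong (λ k → d *ℕ (k ∸ℕ 1)) (*-suc 2 j) ⟨
  d *ℕ (2 *ℕ suc j ∸ℕ 1)                  ∎)
  where
  open ≤-Reasoning
  swap : ∀ a b c → a *ℕ b *ℕ c ≡ a *ℕ c *ℕ b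
  swap = solve-∀
  halved : suc j *ℕ m ≤ d
  halved = *-cancelˡ-≤ 2 (≤-trans (≤-reflexive (double j m)) (odd-bound (2 *ℕ j) m d le))
    where
    double : ∀ j m → 2 *ℕ (suc j *ℕ m) ≡ (2 +ℕ 2 *ℕ j) *ℕ m
    double = solve-∀

even-numerics : ∀ g {m d} → 2 ∣ g → (g ≤ 2 → g *ℕ m ≤ d) → Combined g m d → g *ℕ g *ℕ m ≤ d *ℕ (2 *ℕ g ∸ℕ 2)
even-numerics 0 _ _ _ = z≤n
even-numerics 1 (divides zero    ()) _ _
even-numerics 1 (divides (suc _) ()) _ _
-- The denominator is 2, so the claim is twice the bound for few classes.
even-numerics 2 {m} {d} _ small _ = begin
  4 *ℕ m        ≡⟨ *-assoc 2 2 m ⟩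
  2 *ℕ (2 *ℕ m) ≤⟨ *-monoʳ-≤ 2 (small ≤-refl) ⟩
  2 *ℕ d        ≡⟨ *-comm 2 d ⟩
  d *ℕ 2        ∎
  where open ≤-Reasoning
even-numerics 3 (divides (suc zero) ()) _ _
even-numerics 3 (divides (suc (suc _)) ()) _ _
even-numerics (suc (suc (suc (suc k)))) {m} {d} _ _ le =
  ≤-trans (even-bound k m d le) (≤-reflexive (cong (λ b → d *ℕ (b ∸ℕ 2)) (sym (*-distribˡ-+ 2 4 k))))

-- Transfer to the encoded product graph and conclusion.

module _ (G H : Graph) {n m d : ℕ} (isγG : Graph.IsDominationNumber G n) (isγH : Graph.IsDominationNumber H m)
         (isγG□H : Graph.IsDominationNumber (G □ H) d) where

  private
    module G = Graph G
    module H = Graph H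
    module G□H = Graph (G □ H)

    S : Subset G□H.order
    S = proj₁ (G□H.IsDominationNumber.attained isγG□H)

    D : G.Vertex → H.Vertex → Set
    D x v = combine x v ∈ S

    D? : ∀ x v → Dec (D x v)
    D? x v = combine x v ∈? S

    -- Equality and edges of `G` stay in column `v`, while edges of `H` stay in the fibre over `x`.
    dominates : ∀ x v → (∃ λ y → D y v × x U.∈ G.N[ y ]) ⊎ (∃ λ w → D x w × v H.~ w)
    dominates x v with proj₁ (proj₂ (G□H.IsDominationNumber.attained isγG□H)) (combine x v)
    ... | _ , z∈S , inj₁ refl = inj₁ (x , z∈S , inj₁ refl)
    ... | z , z∈S , inj₂ adj = [ fibreG , fibreH ]′ adj
      where
      y = proj₁ (remQuot {G.order} H.order z)
      w = proj₂ (remQuot {G.order} H.order z)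
      z≡ : z ≡ combine y w
      z≡ = sym (combine-remQuot {G.order} H.order z)
      ≡x = cong proj₁ (remQuot-combine x v)
      ≡v = cong proj₂ (remQuot-combine x v)
      fibreG = λ (eq , y~x) → inj₁ (y , subst (_∈ S) (trans z≡ (cong (combine y) (trans eq ≡v))) z∈S
                                      , inj₂ (subst (y G.~_) ≡x y~x))
      fibreH = λ (eq , w~v) → inj₂ (w , subst (_∈ S) (trans z≡ (cong (λ u → combine u w) (trans eq ≡x))) z∈S
                                      , H.~-sym (subst (w H.~_) ≡v w~v))

    module B = Bounds G H isγG isγH D? dominates

    ∣D∣≡d : B.∣D∣ ≡ d
    ∣D∣≡d = begin
      B.∣D∣                                          ≡⟨ ∑-comm (λ v x → χ (D? x v)) ⟩
      sum (λ x → sum λ v → χ (D? x v))               ≡⟨ sum-combine G.order H.order (λ z → χ (z ∈? S)) ⟨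
      # (_∈? S)                                      ≡⟨ ∣p∣≡# S ⟨
      ∣ S ∣                                          ≡⟨ proj₂ (proj₂ (G□H.IsDominationNumber.attained isγG□H)) ⟩
      d                                              ∎
      where open ≡-Reasoning

  product-bound : Combined n m d
  product-bound = subst (Combined n m) ∣D∣≡d B.combined-bound

  product-bound-small : n ≤ 2 → n *ℕ m ≤ d
  product-bound-small n≤2 = subst (n *ℕ m ≤_) ∣D∣≡d (B.γG≤2-bound n≤2)

theorem2p5 : (G H : Graph) → Graph.Connected G → Graph.Connected H →
    (¬ (2 ∣ γ G) →
    (+ γ (G □ H) / 1) ≥ _/_ (+ ⌈ γ G /2⌉) (2 *ℕ ⌈ γ G /2⌉ ∸ℕ 1) {{oddDenominator-nonZero G}} * (+ γ G / 1) * (+ γ H / 1))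
    × ((even : 2 ∣ γ G) →
    (+ γ (G □ H) / 1) ≥ _/_ (+ γ G) (2 *ℕ γ G ∸ℕ 2) {{evenDenominator-nonZero G even}} * (+ γ G / 1) * (+ γ H / 1))
theorem2p5 G H _ _ =
    (λ odd  → fraction-≥ ⌈ γ G /2⌉ (2 *ℕ ⌈ γ G /2⌉ ∸ℕ 1) (γ G) (γ H) (γ (G □ H)) {{oddDenominator-nonZero G}}
                (odd-numerics (γ G) odd combined))
  , (λ even → fraction-≥ (γ G) (2 *ℕ γ G ∸ℕ 2) (γ G) (γ H) (γ (G □ H)) {{evenDenominator-nonZero G even}}
                (even-numerics (γ G) even (product-bound-small G H isγG isγH isγG□H) combined))
  where
  isγG   = γ-isDominationNumber G
  isγH   = γ-isDominationNumber H
  isγG□H = γ-isDominationNumber (G □ H)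
  combined = product-bound G H isγG isγH isγG□H
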